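{- Let $\Phi \triangleright \Gamma\vdash t : M$ be a derivation with $M$ solvable. Then there is an $\mathsf s$-normalizing reduction sequence $d : t\to_{\mathsf s}^* u$ with $2|d|_{\mathsf m}+|u|_{\mathsf s}\le |\Phi|_{\mathsf m}$. If moreover $\Gamma$ is an inert type context and $M$ is precisely solvable, then $2|d|_{\mathsf m}+|u|_{\mathsf s} = |\Phi|_{\mathsf m}$.
   Context: Value substitution calculus (VSC). Terms (the set $\Lambda_{\mathsf{vsc}}$) are $t,u,s ::= v \mid tu \mid t[x{\leftarrow}u]$ and values are $v ::= x \mid \lambda x.t$; $t[x{\leftarrow}u]$ is an explicit substitution (ES), binding $x$ in $t$. Terms are up to $\alpha$-renaming; $t\{x{\leftarrow}u\}$ is capture-avoiding substitution. Contexts are terms with exactly one hole $\langle\cdot\rangle$; plugging may capture. Substitution contexts: $L ::= \langle\cdot\rangle \mid L[x{\leftarrow}t]$. Root rules: $L\langle\lambda x.t\rangle u \mapsto_{\mathsf m} L\langle t[x{\leftarrow}u]\rangle$ and $t[x{\leftarrow}L\langle v\rangle] \mapsto_{\mathsf e} L\langle t\{x{\leftarrow}v\}\rangle$ with $v$ a value, where (by $\alpha$-renaming) $L$ captures no free variable of $u$, resp. of $t$. Open contexts: $O ::= \langle\cdot\rangle \mid Ot \mid tO \mid O[x{\leftarrow}t]\mid t[x{\leftarrow}O]$. Solving contexts: $S ::= O \mid \lambda x.S \mid St \mid S[x{\leftarrow}t]$. For $a\in\{\mathsf m,\mathsf e\}$, $\to_{\mathsf{s}a}$ is the closure of $\mapsto_a$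 under solving contexts (open contexts included), and $\to_{\mathsf s} = \to_{\mathsf{sm}}\cup\to_{\mathsf{se}}$. A reduction sequence $d:t\to_{\mathsf s}^*u$ is $\mathsf s$-normalizing if $u$ is $\to_{\mathsf s}$-normal; $|d|_{\mathsf m}$ is the number of $\to_{\mathsf{sm}}$ steps in $d$. Sizes of terms. Open size: $|x|_{\mathsf o}=|\lambda x.t|_{\mathsf o}=0$, $|tu|_{\mathsf o}=|t|_{\mathsf o}+|u|_{\mathsf o}+1$, $|t[x{\leftarrow}u]|_{\mathsf o}=|t|_{\mathsf o}+|u|_{\mathsf o}$. Solvable size: $|x|_{\mathsf s}=0$, $|\lambda x.t|_{\mathsf s}=|t|_{\mathsf s}+1$, $|tu|_{\mathsf s}=|t|_{\mathsf s}+|u|_{\mathsf o}+1$, $|t[x{\leftarrow}u]|_{\mathsf s}=|t|_{\mathsf s}+|u|_{\mathsf o}$. Multi types. Linear types $A ::= X \mid M\multimap N$ ($X$ a fixed ground type) and multi types $M,N ::= [A_1,\dots,A_n]$, $n\ge 0$ (finite multisets). A type context $\Gamma$ is a total function from variables to multi types, equal to the empty multiset $\mathbf 0$ except on finitely many variables; $\uplus$ is multiset sum, extended pointwise to type contexts; $\Gamma, x:M$ denotes the extension of $\Gamma$ (with $\Gamma(x)=\mathbf 0$) mapping $x$ to $M$. Typing rules: - (ax) $x:[A]\vdash x:A$; - ($\lambda$) from $\Gamma,x:M\vdash t:N$ infer $\Gamma\vdash\lambda x.t:M\multimap N$; - (many) for a value $v$ and a finite (possibly empty) set $I$, from $\Gamma_i\vdash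 v:A_i$ for all $i\in I$ infer $\biguplus_{i\in I}\Gamma_i\vdash v:\biguplus_{i\in I}[A_i]$; - (@) from $\Gamma\vdash t:[M\multimap N]$ and $\Delta\vdash u:M$ infer $\Gamma\uplus\Delta\vdash tu:N$; - (es) from $\Gamma,x:M\vdash t:N$ and $\Delta\vdash u:M$ infer $\Gamma\uplus\Delta\vdash t[x{\leftarrow}u]:N$. $\Phi\triangleright\Gamma\vdash t:M$ means that $\Phi$ is a derivation with that conclusion ($M$ a multi type). $|\Phi|_{\mathsf m}$ is the number of occurrences of rules ($\lambda$) and (@) in $\Phi$. Kinds of types. - Inert: multi $M^{\mathsf i}::=[A^{\mathsf i}_1,\dots,A^{\mathsf i}_n]$, $n\ge0$; linear $A^{\mathsf i}::=X\mid n[X]\multimap M^{\mathsf i}$, where $n[X]$ is the multiset with $n\ge0$ copies of $X$. A type context is inert if it assigns only inert multi types. - Solvable: multi $M^{s}::=[A^s_1,\dots,A^s_n]$, $n>0$; linear $A^s::=X\mid M\multimap M^s$ ($M$ any multi type). - Unitary solvable: multi $M^{us}::=[A^{us}]$; linear $A^{us}::=X\mid M\multimap M^{us}$. - Inertly solvable: multi $M^{is}::=[A^{is}_1,\dots,A^{is}_n]$, $n>0$; linear $A^{is}::=X\mid M^{\mathsf i}\multimap M^{is}$. - Precisely solvable: both unitary solvable and inertly solvable. -}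

module Defs where

open import Data.Fin.Base using (Fin; zero; suc; lift)
open import Data.List.Base using (List; []; _∷_; [_]; _++_; foldr; map; replicate)
open import Data.List.Relation.Binary.Permutation.Homogeneous using (Permutation)
open import Data.List.Relation.Unary.All using (All; []; _∷_)
open import Data.Nat.Base using (ℕ; zero; suc; _+_)
open import Data.Product.Base using (_×_; _,_; proj₁; proj₂)
open import Data.Sum.Base using (_⊎_; inj₁; inj₂)
open import Data.Vec.Functional using (Vector; updateAt) renaming (_∷_ to _∷ᵛ_)
open import Function.Base using (_∘_; const; id)
open import Relation.Binary.Construct.Closure.ReflexiveTransitive using (Star; ε; _◅_)
open import Level using (0ℓ)
open import Relation.Binary.Core using (Rel)

private
  variable
    m n k : ℕ

infix  5 ƛ_
infixl 7 _·_
infixl 8 _[←_]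

-- Terms up to α-renaming: well-scoped de Bruijn terms with free variables in
-- Fin n.  In t [← u ], index zero of t is bound by the explicit substitution.
data Term (n : ℕ) : Set where
  var   : Fin n → Term n
  ƛ_    : Term (suc n) → Term n
  _·_   : Term n → Term n → Term n
  _[←_] : Term (suc n) → Term n → Term n

data Value {n : ℕ} : Term n → Set where
  var : (x : Fin n) → Value (var x)
  ƛ_  : (t : Term (suc n)) → Value (ƛ t)

rename : (Fin m → Fin n) → Term m → Term n
rename ρ (var x)    = var (ρ x)
rename ρ (ƛ t)      = ƛ rename (lift 1 ρ) t
rename ρ (t · u)    = rename ρ t · rename ρ u
rename ρ (t [← u ]) = rename (lift 1 ρ) t [← rename ρ u ]

exts : (Fin m → Term n) → Fin (suc m) → Term (suc n)
exts σ zero    = var zero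
exts σ (suc x) = rename suc (σ x)

subst : (Fin m → Term n) → Term m → Term n
subst σ (var x)    = σ x
subst σ (ƛ t)      = ƛ subst (exts σ) t
subst σ (t · u)    = subst σ t · subst σ u
subst σ (t [← u ]) = subst (exts σ) t [← subst σ u ]

-- t{x←u} for x the variable of index zero.
infixl 8 _⟦_⟧
_⟦_⟧ : Term (suc n) → Term n → Term n
t ⟦ u ⟧ = subst (u ∷ᵛ var) t

-- Contexts are indexed by the scope of the whole term and the scope of the
-- hole; plugging leaves the plugged term unchanged, hence may capture.
data SubstCtx : ℕ → ℕ → Set where
  □     : SubstCtx n n
  _[←_] : SubstCtx (suc n) k → Term n → SubstCtx n k

data OpenCtx : ℕ → ℕ → Set where
  □      : OpenCtx n n
  _·ˡ_   : OpenCtx n k → Term n → OpenCtx n k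
  _·ʳ_   : Term n → OpenCtx n k → OpenCtx n k
  _[←_]ˡ : OpenCtx (suc n) k → Term n → OpenCtx n k
  _[←_]ʳ : Term (suc n) → OpenCtx n k → OpenCtx n k

data SolvCtx : ℕ → ℕ → Set where
  open′  : OpenCtx n k → SolvCtx n k
  ƛ_     : SolvCtx (suc n) k → SolvCtx n k
  _·ˡ_   : SolvCtx n k → Term n → SolvCtx n k
  _[←_]ˡ : SolvCtx (suc n) k → Term n → SolvCtx n k

infix 9 _⟨_⟩ᴸ _⟨_⟩ᴼ _⟨_⟩ˢ

_⟨_⟩ᴸ : SubstCtx n k → Term k → Term n
□          ⟨ r ⟩ᴸ = r
(L [← t ]) ⟨ r ⟩ᴸ = L ⟨ r ⟩ᴸ [← t ]

_⟨_⟩ᴼ : OpenCtx n k → Term k → Term n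
□           ⟨ r ⟩ᴼ = r
(O ·ˡ t)    ⟨ r ⟩ᴼ = O ⟨ r ⟩ᴼ · t
(t ·ʳ O)    ⟨ r ⟩ᴼ = t · O ⟨ r ⟩ᴼ
(O [← t ]ˡ) ⟨ r ⟩ᴼ = O ⟨ r ⟩ᴼ [← t ]
(t [← O ]ʳ) ⟨ r ⟩ᴼ = t [← O ⟨ r ⟩ᴼ ]

_⟨_⟩ˢ : SolvCtx n k → Term k → Term n
open′ O     ⟨ r ⟩ˢ = O ⟨ r ⟩ᴼ
(ƛ S)       ⟨ r ⟩ˢ = ƛ S ⟨ r ⟩ˢ
(S ·ˡ t)    ⟨ r ⟩ˢ = S ⟨ r ⟩ˢ · t
(S [← t ]ˡ) ⟨ r ⟩ˢ = S ⟨ r ⟩ˢ [← t ]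

-- The embedding of the scope of L⟨·⟩ into the scope of its hole.  Renaming
-- along it is what makes L capture no variable of a term moved under L.
wk : SubstCtx n k → Fin n → Fin k
wk □          = id
wk (L [← t ]) = wk L ∘ suc

infix 4 _↦m_ _↦e_

data _↦m_ {n : ℕ} : Rel (Term n) 0ℓ where
  root-m : (L : SubstCtx n k) (t : Term (suc k)) (u : Term n) →
           L ⟨ ƛ t ⟩ᴸ · u ↦m L ⟨ t [← rename (wk L) u ] ⟩ᴸ

data _↦e_ {n : ℕ} : Rel (Term n) 0ℓ where
  root-e : (t : Term (suc n)) (L : SubstCtx n k) {v : Term k} → Value v →
           t [← L ⟨ v ⟩ᴸ ] ↦e L ⟨ rename (lift 1 (wk L)) t ⟦ v ⟧ ⟩ᴸ

data SolvClosure (R : ∀ {k} → Rel (Term k) 0ℓ) {n : ℕ} : Rel (Term n) 0ℓ where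
  close : (S : SolvCtx n k) {r r′ : Term k} → R r r′ →
          SolvClosure R (S ⟨ r ⟩ˢ) (S ⟨ r′ ⟩ˢ)

infix 4 _→sm_ _→se_ _→s_ _→s*_

_→sm_ _→se_ _→s_ _→s*_ : Rel (Term n) 0ℓ
_→sm_    = SolvClosure _↦m_
_→se_    = SolvClosure _↦e_
t →s u   = t →sm u ⊎ t →se u
_→s*_    = Star _→s_

∣_∣ᵈ : {t u : Term n} → t →s* u → ℕ
∣ ε ∣ᵈ          = 0
∣ inj₁ _ ◅ d ∣ᵈ = suc ∣ d ∣ᵈ
∣ inj₂ _ ◅ d ∣ᵈ = ∣ d ∣ᵈ

∣_∣ᵒ : Term n → ℕ
∣ var x ∣ᵒ    = 0
∣ ƛ t ∣ᵒ      = 0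
∣ t · u ∣ᵒ    = ∣ t ∣ᵒ + ∣ u ∣ᵒ + 1
∣ t [← u ] ∣ᵒ = ∣ t ∣ᵒ + ∣ u ∣ᵒ

∣_∣ˢ : Term n → ℕ
∣ var x ∣ˢ    = 0
∣ ƛ t ∣ˢ      = ∣ t ∣ˢ + 1
∣ t · u ∣ˢ    = ∣ t ∣ˢ + ∣ u ∣ᵒ + 1
∣ t [← u ] ∣ˢ = ∣ t ∣ˢ + ∣ u ∣ᵒ

-- Finite multisets are lists taken up to _≈ᵐ_, which permutes elements at
-- every depth.
infixr 6 _⊸_

data Linear : Set

Multi : Set
Multi = List Linear

data Linear where
  X   : Linear
  _⊸_ : Multi → Multi → Linear

infix 4 _≈ˡ_ _≈ᵐ_ _≈ᶜ_

data _≈ˡ_ : Rel Linear 0ℓ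

_≈ᵐ_ : Rel Multi 0ℓ
_≈ᵐ_ = Permutation _≈ˡ_

data _≈ˡ_ where
  X   : X ≈ˡ X
  _⊸_ : ∀ {M M′ N N′} → M ≈ᵐ M′ → N ≈ᵐ N′ → M ⊸ N ≈ˡ M′ ⊸ N′

-- All variables in scope are in the finite set Fin n, so every function from
-- Fin n has finite support.
TypeCtx : ℕ → Set
TypeCtx n = Vector Multi n

_≈ᶜ_ : Rel (TypeCtx n) 0ℓ
Γ ≈ᶜ Δ = ∀ x → Γ x ≈ᵐ Δ x

𝟎 : TypeCtx n
𝟎 x = []

infixl 6 _⊎ᶜ_
_⊎ᶜ_ : TypeCtx n → TypeCtx n → TypeCtx n
(Γ ⊎ᶜ Δ) x = Γ x ++ Δ x

⨄ : List (TypeCtx n) → TypeCtx n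
⨄ = foldr _⊎ᶜ_ 𝟎

_↦_ : Fin n → Multi → TypeCtx n
x ↦ M = updateAt 𝟎 x (const M)

infix 4 _⊢ˡ_∶_ _⊢_∶_

-- Γ ⊢ˡ t ∶ A and Γ ⊢ t ∶ M are the judgements with a linear and with a multi
-- type.  Rules that build a multiset in their conclusion do so up to
-- equality of multisets; the family (Γᵢ , Aᵢ) of the rule many is the list Ps.
data _⊢ˡ_∶_ {n : ℕ} (Γ : TypeCtx n) : Term n → Linear → Set
data _⊢_∶_ {n : ℕ} (Γ : TypeCtx n) : Term n → Multi → Set

data _⊢ˡ_∶_ {n} Γ where
  ax  : ∀ {x A} →
        Γ ≈ᶜ x ↦ [ A ] →
        Γ ⊢ˡ var x ∶ A
  lam : ∀ {t M N} →
        M ∷ᵛ Γ ⊢ t ∶ N →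
        Γ ⊢ˡ ƛ t ∶ M ⊸ N

data _⊢_∶_ {n} Γ where
  many : ∀ {v M} → Value v → (Ps : List (TypeCtx n × Linear)) →
         All (λ P → proj₁ P ⊢ˡ v ∶ proj₂ P) Ps →
         Γ ≈ᶜ ⨄ (map proj₁ Ps) → M ≈ᵐ map proj₂ Ps →
         Γ ⊢ v ∶ M
  app  : ∀ {t u M N} (Δ Θ : TypeCtx n) →
         Δ ⊢ t ∶ [ M ⊸ N ] → Θ ⊢ u ∶ M →
         Γ ≈ᶜ Δ ⊎ᶜ Θ →
         Γ ⊢ t · u ∶ N
  es   : ∀ {t u M N} (Δ Θ : TypeCtx n) →
         M ∷ᵛ Δ ⊢ t ∶ N → Θ ⊢ u ∶ M →
         Γ ≈ᶜ Δ ⊎ᶜ Θ →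
         Γ ⊢ t [← u ] ∶ N

∣_∣ᵐˡ : {Γ : TypeCtx n} {t : Term n} {A : Linear} → Γ ⊢ˡ t ∶ A → ℕ
∣_∣ᵐ  : {Γ : TypeCtx n} {t : Term n} {M : Multi} → Γ ⊢ t ∶ M → ℕ
∣_∣ᵐ* : {v : Term n} {Ps : List (TypeCtx n × Linear)} →
        All (λ P → proj₁ P ⊢ˡ v ∶ proj₂ P) Ps → ℕ

∣ ax _ ∣ᵐˡ  = 0
∣ lam Φ ∣ᵐˡ = suc ∣ Φ ∣ᵐ

∣ many _ _ Φs _ _ ∣ᵐ = ∣ Φs ∣ᵐ*
∣ app _ _ Φ Ψ _ ∣ᵐ   = suc (∣ Φ ∣ᵐ + ∣ Ψ ∣ᵐ)
∣ es _ _ Φ Ψ _ ∣ᵐ    = ∣ Φ ∣ᵐ + ∣ Ψ ∣ᵐ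

∣ [] ∣ᵐ*     = 0
∣ Φ ∷ Φs ∣ᵐ* = ∣ Φ ∣ᵐˡ + ∣ Φs ∣ᵐ*

data InertLinear : Linear → Set

Inert : Multi → Set
Inert = All InertLinear

data InertLinear where
  X   : InertLinear X
  _⊸_ : ∀ j {M} → Inert M → InertLinear (replicate j X ⊸ M)

InertCtx : TypeCtx n → Set
InertCtx Γ = ∀ x → Inert (Γ x)

data SolvableLinear : Linear → Set
data Solvable : Multi → Set

data SolvableLinear where
  X   : SolvableLinear X
  _⊸_ : ∀ M {N} → Solvable N → SolvableLinear (M ⊸ N)

data Solvable where
  nonempty : ∀ {A As} → All SolvableLinear (A ∷ As) → Solvable (A ∷ As)

data UnitarySolvableLinear : Linear → Set
data UnitarySolvable : Multi → Set

data UnitarySolvableLinear where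
  X   : UnitarySolvableLinear X
  _⊸_ : ∀ M {N} → UnitarySolvable N → UnitarySolvableLinear (M ⊸ N)

data UnitarySolvable where
  unit : ∀ {A} → UnitarySolvableLinear A → UnitarySolvable [ A ]

data InertlySolvableLinear : Linear → Set
data InertlySolvable : Multi → Set

data InertlySolvableLinear where
  X   : InertlySolvableLinear X
  _⊸_ : ∀ {M N} → Inert M → InertlySolvable N → InertlySolvableLinear (M ⊸ N)

data InertlySolvable where
  nonempty : ∀ {A As} → All InertlySolvableLinear (A ∷ As) →
             InertlySolvable (A ∷ As)

PreciselySolvable : Multi → Set
PreciselySolvable M = UnitarySolvable M × InertlySolvable M

{-# OPTIONS --safe #-}
-- Weigh a derivation by its rules λ and @, plus c for each rule es.  A
-- substitution lemma in which weights add up gives quantitative subject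
-- reduction: an m-step trades weight 2 for c and an e-step removes c, each
-- multiplied by the number of derivations that type the redex.  That number is
-- positive when the type is solvable and 1 when it is unitary solvable.  Hence
-- for c = 1 every step decreases the weight, so reduction terminates, while for
-- c = 0 the weight |Φ|ₘ pays 2 for each m-step.  It remains to compare the
-- weight and the size of the normal form: inert contexts give inert types to
-- the normal forms that are not abstractions under substitutions, so their
-- arguments have types n[X] and hide no weight below λ.
module Submission where

open import Defs
open import Algebra.Bundles using (CommutativeMonoid)
import Algebra.Properties.CommutativeSemigroup as CommutativeSemigroupProperties
open import Data.Fin.Base using (Fin; zero; suc; lift)
open import Data.List.Base using (List; []; _∷_; [_]; _++_; map; replicate)
open import Data.List.Properties using (map-++; map-∘; map-id; ++-assoc; ++-identityʳ)
open import Data.List.Relation.Binary.Permutation.Homogeneous using (refl; prep; swap; trans)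
import Data.List.Relation.Binary.Permutation.Setoid as SetoidPermutation
import Data.List.Relation.Binary.Permutation.Setoid.Properties as SetoidPermutationProperties
open import Data.List.Relation.Binary.Pointwise.Base using (Pointwise; []; _∷_)
open import Data.List.Relation.Unary.All using (All; []; _∷_)
open import Data.List.Relation.Unary.All.Properties using (++⁻; map⁺; replicate⁺) renaming (++⁺ to ++⁺ᴬ)
open import Data.Nat.Base using (ℕ; zero; suc; _+_; _*_; _≤_; _<_; z≤n; s≤s)
open import Data.Nat.Induction using (<-rec)
open import Data.Nat.Properties using
  ( +-assoc; +-comm; +-identityʳ; *-identityˡ; *-zeroʳ; ≤-refl; ≤-reflexive; ≤-trans
  ; +-mono-≤; +-monoˡ-≤; +-monoʳ-≤; *-monoʳ-≤; m≤m+n; m≤n+m )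
open import Data.Nat.Tactic.RingSolver using (solve-∀)
open import Data.Product.Base using (∃; ∃-syntax; Σ-syntax; _×_; _,_; proj₁; proj₂; map₁)
open import Data.Product.Relation.Binary.Pointwise.NonDependent using (×-setoid)
open import Data.Sum.Base using (_⊎_; inj₁; inj₂)
open import Data.Vec.Functional using () renaming (_∷_ to _∷ᵛ_)
open import Function.Base using (_∘_)
open import Level using (0ℓ)
open import Relation.Binary.Bundles using (Setoid)
open import Relation.Binary.Construct.Closure.ReflexiveTransitive using (ε; _◅_)
open import Relation.Binary.Core using (Rel)
open import Relation.Binary.PropositionalEquality using (_≡_; refl; sym; cong; cong₂; setoid)
  renaming (trans to ≡-trans)
open import Relation.Binary.Rewriting using (IsNormalForm)
open import Relation.Nullary using (¬_; contradiction)

private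
  variable
    m n k : ℕ

-- Equality of types

mutual
  ≈ˡ-refl : ∀ {A} → A ≈ˡ A
  ≈ˡ-refl {X}     = X
  ≈ˡ-refl {M ⊸ N} = refl ≋ᵐ-refl ⊸ refl ≋ᵐ-refl

  ≋ᵐ-refl : ∀ {M} → Pointwise _≈ˡ_ M M
  ≋ᵐ-refl {[]}    = []
  ≋ᵐ-refl {_ ∷ _} = ≈ˡ-refl ∷ ≋ᵐ-refl

mutual
  ≈ˡ-sym : ∀ {A B} → A ≈ˡ B → B ≈ˡ A
  ≈ˡ-sym X       = X
  ≈ˡ-sym (p ⊸ q) = ≈ᵐ-sym p ⊸ ≈ᵐ-sym q

  ≈ᵐ-sym : ∀ {M N} → M ≈ᵐ N → N ≈ᵐ M
  ≈ᵐ-sym (refl p)     = refl (≋ᵐ-sym p)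
  ≈ᵐ-sym (prep e p)   = prep (≈ˡ-sym e) (≈ᵐ-sym p)
  ≈ᵐ-sym (swap e f p) = swap (≈ˡ-sym f) (≈ˡ-sym e) (≈ᵐ-sym p)
  ≈ᵐ-sym (trans p q)  = trans (≈ᵐ-sym q) (≈ᵐ-sym p)

  ≋ᵐ-sym : ∀ {M N} → Pointwise _≈ˡ_ M N → Pointwise _≈ˡ_ N M
  ≋ᵐ-sym []      = []
  ≋ᵐ-sym (e ∷ p) = ≈ˡ-sym e ∷ ≋ᵐ-sym p

≈ˡ-trans : ∀ {A B C} → A ≈ˡ B → B ≈ˡ C → A ≈ˡ C
≈ˡ-trans X         X         = X
≈ˡ-trans (p ⊸ q) (p′ ⊸ q′) = trans p p′ ⊸ trans q q′

-- Labelled types and their permutations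

linearSetoid : Setoid 0ℓ 0ℓ
linearSetoid = record
  { _≈_           = _≈ˡ_
  ; isEquivalence = record { refl = ≈ˡ-refl ; sym = ≈ˡ-sym ; trans = ≈ˡ-trans }
  }

-- The labels `I` are variables in contexts and terms in families of judgements, so one theory of
-- permutations serves both.
typedSetoid : Set → Setoid 0ℓ 0ℓ
typedSetoid I = ×-setoid (setoid I) linearSetoid

open module Perm {I} = SetoidPermutation (typedSetoid I)
  using (_↭_; ↭-refl; ↭-sym; ↭-reflexive)
open module PermProperties {I} = SetoidPermutationProperties (typedSetoid I)
  using (++⁺; ++-comm)
open module PermSemigroup {I} = CommutativeSemigroupProperties
  (CommutativeMonoid.commutativeSemigroup
    (SetoidPermutationProperties.++-commutativeMonoid (typedSetoid I)))
  using (interchange; xy∙z≈xz∙y; x∙yz≈y∙xz)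

-- A type context as the list of its occurrences: x : [A₁ , … , Aₙ] is
-- (x , A₁) , … , (x , Aₙ).
Occs : ℕ → Set
Occs n = List (Fin n × Linear)

label : {I : Set} → I → Multi → List (I × Linear)
label i = map (i ,_)

relabel : {I J : Set} → (I → J) → List (I × Linear) → List (J × Linear)
relabel f = map (map₁ f)

bind : Multi → Occs n → Occs (suc n)
bind M G = label zero M ++ relabel suc G

label-≈ : {I : Set} {i : I} {M N : Multi} → M ≈ᵐ N → label i M ↭ label i N
label-≈ = SetoidPermutationProperties.map⁺ linearSetoid (typedSetoid _) (refl ,_)

relabel-↭ : {I J : Set} (f : I → J) {G H : List (I × Linear)} → G ↭ H → relabel f G ↭ relabel f H
relabel-↭ f = SetoidPermutationProperties.map⁺ (typedSetoid _) (typedSetoid _) (λ (p , q) → cong f p , q)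

bind-≈ : {M N : Multi} {G H : Occs n} → M ≈ᵐ N → G ↭ H → bind M G ↭ bind N H
bind-≈ p q = ++⁺ (label-≈ p) (relabel-↭ suc q)

bind-++ : (M : Multi) (G H : Occs n) → bind M G ++ relabel suc H ≡ bind M (G ++ H)
bind-++ M G H = ≡-trans (++-assoc (label zero M) _ _)
  (cong (label zero M ++_) (sym (map-++ (map₁ suc) G H)))

relabel-lift : (ρ : Fin m → Fin n) (M : Multi) (G : Occs m) →
               relabel (lift 1 ρ) (bind M G) ≡ bind M (relabel ρ G)
relabel-lift ρ M G = ≡-trans (map-++ (map₁ (lift 1 ρ)) (label zero M) _)
  (cong₂ _++_ (sym (map-∘ M)) (≡-trans (sym (map-∘ G)) (map-∘ G)))

flatten : TypeCtx n → Occs n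
flatten {zero}  Γ = []
flatten {suc n} Γ = bind (Γ zero) (flatten (Γ ∘ suc))

flatten-≈ : {Γ Δ : TypeCtx n} → Γ ≈ᶜ Δ → flatten Γ ↭ flatten Δ
flatten-≈ {zero}  p = ↭-refl
flatten-≈ {suc n} p = bind-≈ (p zero) (flatten-≈ (p ∘ suc))

flatten-⊎ : (Γ Δ : TypeCtx n) → flatten (Γ ⊎ᶜ Δ) ↭ flatten Γ ++ flatten Δ
flatten-⊎ {zero}  Γ Δ = ↭-refl
flatten-⊎ {suc n} Γ Δ = trans (bind-≈ (refl ≋ᵐ-refl) (flatten-⊎ (Γ ∘ suc) (Δ ∘ suc)))
  (trans (↭-reflexive (cong₂ _++_ (map-++ (zero ,_) (Γ zero) (Δ zero))
                                  (map-++ (map₁ suc) (flatten (Γ ∘ suc)) _)))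
    (interchange (label zero (Γ zero)) (label zero (Δ zero)) (relabel suc (flatten (Γ ∘ suc))) _))

flatten-𝟎 : ∀ n → flatten {n} 𝟎 ≡ []
flatten-𝟎 zero    = refl
flatten-𝟎 (suc n) = cong (relabel suc) (flatten-𝟎 n)

flatten-↦ : (x : Fin n) {A : Linear} → flatten (x ↦ [ A ]) ↭ [ x , A ]
flatten-↦ {suc n} zero    = ↭-reflexive (cong (λ G → (zero , _) ∷ relabel suc G) (flatten-𝟎 n))
flatten-↦ {suc n} (suc x) = relabel-↭ suc (flatten-↦ x)

+-interchange : ∀ a b x y → (a + b) + (x + y) ≡ (a + x) + (b + y)
+-interchange = solve-∀

pull-app : ∀ α h b → suc (α + h + b) ≡ α + suc (h + b)
pull-app = solve-∀

pull-es : ∀ c α h b → c + (α + h + b) ≡ α + (c + (h + b))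
pull-es = solve-∀

weight-+ : ∀ a b c i j → a + b + c * (i + j) ≡ (a + c * i) + (b + c * j)
weight-+ = solve-∀

-- Weighted derivations and their structural rules

module Weighted (c : ℕ) where

  infix 4 _⊩ˡ_∶_▹_ _⊩_∶_▹_ _⊩*_▹_

  -- The last index is the weight.  G ⊩* Js types every (t , A) in Js, so that the
  -- premises of the rule many and a typed substitution are both instances of it.
  data _⊩ˡ_∶_▹_ {n : ℕ} (G : Occs n) : Term n → Linear → ℕ → Set
  data _⊩_∶_▹_ {n : ℕ} (G : Occs n) : Term n → Multi → ℕ → Set
  data _⊩*_▹_ {n : ℕ} (G : Occs n) : List (Term n × Linear) → ℕ → Set

  data _⊩ˡ_∶_▹_ {n} G where
    ax  : ∀ {x A} → G ↭ [ x , A ] → G ⊩ˡ var x ∶ A ▹ 0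
    lam : ∀ {t M N H s} → bind M H ⊩ t ∶ N ▹ s → G ↭ H → G ⊩ˡ ƛ t ∶ M ⊸ N ▹ suc s

  data _⊩_∶_▹_ {n} G where
    many : ∀ {v M N s} → Value v → G ⊩* label v N ▹ s → M ≈ᵐ N → G ⊩ v ∶ M ▹ s
    app  : ∀ {t u M N H K a b s} → H ⊩ t ∶ [ M ⊸ N ] ▹ a → K ⊩ u ∶ M ▹ b →
           G ↭ H ++ K → s ≡ suc (a + b) → G ⊩ t · u ∶ N ▹ s
    es   : ∀ {t u M N H K a b s} → bind M H ⊩ t ∶ N ▹ a → K ⊩ u ∶ M ▹ b →
           G ↭ H ++ K → s ≡ c + (a + b) → G ⊩ t [← u ] ∶ N ▹ s

  data _⊩*_▹_ {n} G where
    nil  : G ↭ [] → G ⊩* [] ▹ 0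
    cons : ∀ {t A Js H K a b s} → H ⊩ˡ t ∶ A ▹ a → K ⊩* Js ▹ b →
           G ↭ H ++ K → s ≡ a + b → G ⊩* (t , A) ∷ Js ▹ s

  reweighˡ : ∀ {G : Occs n} {t A a b} → a ≡ b → G ⊩ˡ t ∶ A ▹ a → G ⊩ˡ t ∶ A ▹ b
  reweighˡ refl d = d

  reweigh : ∀ {G : Occs n} {t M a b} → a ≡ b → G ⊩ t ∶ M ▹ a → G ⊩ t ∶ M ▹ b
  reweigh refl d = d

  reweigh* : ∀ {G : Occs n} {Js a b} → a ≡ b → G ⊩* Js ▹ a → G ⊩* Js ▹ b
  reweigh* refl d = d

  retype : ∀ {G : Occs n} {Js Ks s} → Js ≡ Ks → G ⊩* Js ▹ s → G ⊩* Ks ▹ s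
  retype refl d = d

  exchangeˡ : ∀ {G H : Occs n} {t A s} → G ↭ H → H ⊩ˡ t ∶ A ▹ s → G ⊩ˡ t ∶ A ▹ s
  exchangeˡ p (ax q)    = ax (trans p q)
  exchangeˡ p (lam d q) = lam d (trans p q)

  exchange* : ∀ {G H : Occs n} {Js s} → G ↭ H → H ⊩* Js ▹ s → G ⊩* Js ▹ s
  exchange* p (nil q)        = nil (trans p q)
  exchange* p (cons d e q r) = cons d e (trans p q) r

  exchange : ∀ {G H : Occs n} {t M s} → G ↭ H → H ⊩ t ∶ M ▹ s → G ⊩ t ∶ M ▹ s
  exchange p (many v d q)  = many v (exchange* p d) q
  exchange p (app d e q r) = app d e (trans p q) r
  exchange p (es d e q r)  = es d e (trans p q) r

  -- The result type of an application occurs only inside the arrow type of its function, so the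
  -- conversion is made there.
  convert : ∀ {G : Occs n} {t M N s} → M ≈ᵐ N → G ⊩ t ∶ N ▹ s → G ⊩ t ∶ M ▹ s
  convert p (many v d q)  = many v d (trans p q)
  convert p (app d e q r) = app (convert (refl ((refl ≋ᵐ-refl ⊸ p) ∷ [])) d) e q r
  convert p (es d e q r)  = es (convert p d) e q r

  convertˡ : ∀ {G : Occs n} {t A B s} → A ≈ˡ B → G ⊩ˡ t ∶ B ▹ s → G ⊩ˡ t ∶ A ▹ s
  convertˡ p       (ax q)    = ax (trans q (refl ((refl , ≈ˡ-sym p) ∷ [])))
  convertˡ (p ⊸ q) (lam d r) = lam (exchange (bind-≈ p ↭-refl) (convert q d)) r

  permute : ∀ {G : Occs n} {Js Ks s} → Js ↭ Ks → G ⊩* Ks ▹ s → G ⊩* Js ▹ s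
  permute (refl [])               d              = d
  permute (refl ((refl , p) ∷ q)) (cons d e r z) = cons (convertˡ p d) (permute (refl q) e) r z
  permute (prep (refl , p) q)     (cons d e r z) = cons (convertˡ p d) (permute q e) r z
  permute (swap (refl , p) (refl , p′) q) (cons {H = H} {a = a} d (cons {H = H′} {K} {a′} {b} d′ e r′ refl) r refl) =
    cons (convertˡ p d′) (cons (convertˡ p′ d) (permute q e) ↭-refl refl)
      (trans r (trans (++⁺ ↭-refl r′) (x∙yz≈y∙xz H H′ K)))
      (lemma a a′ b)
    where
      lemma : ∀ a a′ b → a + (a′ + b) ≡ a′ + (a + b)
      lemma = solve-∀
  permute (trans p q) d = permute p (permute q d)

  append : ∀ {G H : Occs n} {Js Ks a b} → G ⊩* Js ▹ a → H ⊩* Ks ▹ b → G ++ H ⊩* Js ++ Ks ▹ a + b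
  append (nil p) e = exchange* (++⁺ p ↭-refl) e
  append (cons {H = I} {K} {a = a} d d′ p refl) e = cons d (append d′ e)
    (trans (++⁺ p ↭-refl) (↭-reflexive (++-assoc I K _))) (+-assoc a _ _)

  split : ∀ {G : Occs n} Js {Ks s} → G ⊩* Js ++ Ks ▹ s →
          ∃[ H ] ∃[ K ] ∃[ a ] ∃[ b ] (G ↭ H ++ K × s ≡ a + b × H ⊩* Js ▹ a × K ⊩* Ks ▹ b)
  split []       d = _ , _ , _ , _ , ↭-refl , refl , nil ↭-refl , d
  split (_ ∷ Js) (cons {H = I} {a = a} d d′ p refl) with split Js d′
  ... | H , K , x , y , q , refl , e , f =
    _ , _ , _ , _ , trans p (trans (++⁺ ↭-refl q) (↭-reflexive (sym (++-assoc I H K))))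
      , sym (+-assoc a x y) , cons d e ↭-refl refl , f

  -- The evidence `Value v` leaves `many` as the only rule, and its equality of multisets is
  -- absorbed by `permute`.
  family : ∀ {G : Occs n} {v M s} → Value v → G ⊩ v ∶ M ▹ s → G ⊩* label v M ▹ s
  family _ (many _ d p) = permute (label-≈ p) d

  singleton : ∀ {G : Occs n} {t A s} → G ⊩* [ t , A ] ▹ s → G ⊩ˡ t ∶ A ▹ s
  singleton {t = t} {A} (cons {H = H} {a = a} d (nil q) p refl) =
    reweighˡ (sym (+-identityʳ a))
      (exchangeˡ (trans p (trans (++⁺ ↭-refl q) (↭-reflexive (++-identityʳ H)))) d)

  -- Renaming and substitution

  rename-Value : ∀ (ρ : Fin m → Fin n) {v} → Value v → Value (rename ρ v)
  rename-Value ρ (var x) = var (ρ x)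
  rename-Value ρ (ƛ t)   = ƛ _

  mutual
    rename-⊩ˡ : ∀ (ρ : Fin m → Fin n) {G t A s} → G ⊩ˡ t ∶ A ▹ s → relabel ρ G ⊩ˡ rename ρ t ∶ A ▹ s
    rename-⊩ˡ ρ (ax p)    = ax (relabel-↭ ρ p)
    rename-⊩ˡ ρ (lam {M = M} {H = H} d p) = lam (rename-bind ρ M H d) (relabel-↭ ρ p)

    rename-bind : ∀ (ρ : Fin m → Fin n) M G {t N s} → bind M G ⊩ t ∶ N ▹ s →
                  bind M (relabel ρ G) ⊩ rename (lift 1 ρ) t ∶ N ▹ s
    rename-bind ρ M G d = exchange (↭-reflexive (sym (relabel-lift ρ M G))) (rename-⊩ (lift 1 ρ) d)

    rename-⊩ : ∀ (ρ : Fin m → Fin n) {G t M s} → G ⊩ t ∶ M ▹ s → relabel ρ G ⊩ rename ρ t ∶ M ▹ s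
    rename-⊩ ρ (many {N = N} v d p) = many (rename-Value ρ v)
      (retype (sym (map-∘ N)) (rename-⊩* ρ d)) p
    rename-⊩ ρ (app {H = H} d e p r) =
      app (rename-⊩ ρ d) (rename-⊩ ρ e) (trans (relabel-↭ ρ p) (↭-reflexive (map-++ (map₁ ρ) H _))) r
    rename-⊩ ρ (es {M = M} {H = H} d e p r) =
      es (rename-bind ρ M H d) (rename-⊩ ρ e) (trans (relabel-↭ ρ p) (↭-reflexive (map-++ (map₁ ρ) H _))) r

    rename-⊩* : ∀ (ρ : Fin m → Fin n) {G Js s} → G ⊩* Js ▹ s → relabel ρ G ⊩* relabel (rename ρ) Js ▹ s
    rename-⊩* ρ (nil p) = nil (relabel-↭ ρ p)
    rename-⊩* ρ (cons {H = H} d e p r) =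
      cons (rename-⊩ˡ ρ d) (rename-⊩* ρ e) (trans (relabel-↭ ρ p) (↭-reflexive (map-++ (map₁ ρ) H _))) r

  relabel-exts : ∀ (σ : Fin m → Term n) M G →
                 relabel (exts σ) (bind M G) ≡ relabel var (label zero M) ++ relabel (rename suc) (relabel σ G)
  relabel-exts σ M G = ≡-trans (map-++ (map₁ (exts σ)) (label zero M) _)
    (cong₂ _++_ (≡-trans (sym (map-∘ M)) (map-∘ M)) (≡-trans (sym (map-∘ G)) (map-∘ G)))

  -- This types the identity part of a substitution, at no cost because axioms have weight 0.
  variables : ∀ (G : Occs n) → G ⊩* relabel var G ▹ 0
  variables []      = nil ↭-refl
  variables (_ ∷ G) = cons (ax ↭-refl) (variables G) ↭-refl refl

  exts-⊩* : ∀ (σ : Fin m → Term n) M G {D s} → D ⊩* relabel σ G ▹ s →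
            bind M D ⊩* relabel (exts σ) (bind M G) ▹ s
  exts-⊩* σ M G d = retype (sym (relabel-exts σ M G))
    (append (variables (label zero M)) (rename-⊩* suc d))

  exts-Value : {σ : Fin m → Term n} → (∀ x → Value (σ x)) → ∀ x → Value (exts σ x)
  exts-Value vs zero    = var zero
  exts-Value vs (suc x) = rename-Value suc (vs x)

  subst-Value : {σ : Fin m → Term n} → (∀ x → Value (σ x)) → ∀ {v} → Value v → Value (subst σ v)
  subst-Value vs (var x) = vs x
  subst-Value vs (ƛ t)   = ƛ _

  -- The substitution is used linearly: the occurrences that go to each premise take their own
  -- derivations along, so none is duplicated or lost.
  split-image : ∀ (σ : Fin m → Term n) {G H K D s} → G ↭ H ++ K → D ⊩* relabel σ G ▹ s →
    ∃[ D₁ ] ∃[ D₂ ] ∃[ a ] ∃[ b ] (D ↭ D₁ ++ D₂ × s ≡ a + b × D₁ ⊩* relabel σ H ▹ a × D₂ ⊩* relabel σ K ▹ b)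
  split-image σ {H = H} {K} p d = split (relabel σ H)
    (retype (map-++ (map₁ σ) H K) (permute (relabel-↭ σ (↭-sym p)) d))

  mutual
    -- A typed substitution supplies one derivation of `σ x` per occurrence `(x , A)` in `G`. Each
    -- axiom has weight 0 and is replaced by exactly one of them, hence weights add. The images are
    -- values because `many` types nothing else.
    subst-⊩ˡ : ∀ {σ : Fin m → Term n} → (∀ x → Value (σ x)) → ∀ {G D t A a b} →
               G ⊩ˡ t ∶ A ▹ a → D ⊩* relabel σ G ▹ b → D ⊩ˡ subst σ t ∶ A ▹ a + b
    subst-⊩ˡ {σ = σ} vs (ax p) e = singleton (permute (relabel-↭ σ (↭-sym p)) e)
    subst-⊩ˡ {σ = σ} vs (lam {M = M} {H = H} d p) e =
      lam (subst-⊩ (exts-Value vs) d (exts-⊩* σ M H (permute (relabel-↭ σ (↭-sym p)) e))) ↭-refl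

    subst-⊩ : ∀ {σ : Fin m → Term n} → (∀ x → Value (σ x)) → ∀ {G D t M a b} →
              G ⊩ t ∶ M ▹ a → D ⊩* relabel σ G ▹ b → D ⊩ subst σ t ∶ M ▹ a + b
    subst-⊩ {σ = σ} vs (many {N = N} v d p) e = many (subst-Value vs v)
      (retype (sym (map-∘ N)) (subst-⊩* vs d e)) p
    subst-⊩ {σ = σ} vs (app {H = H} {a = a} {b} d d′ p refl) e with split-image σ {H = H} p e
    ... | _ , _ , x , y , q , refl , e₁ , e₂ =
      app (subst-⊩ vs d e₁) (subst-⊩ vs d′ e₂) q (cong suc (+-interchange a b x y))
    subst-⊩ {σ = σ} vs (es {M = M} {H = H} {a = a} {b} d d′ p refl) e with split-image σ {H = H} p e
    ... | _ , _ , x , y , q , refl , e₁ , e₂ =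
      es (subst-⊩ (exts-Value vs) d (exts-⊩* σ M H e₁)) (subst-⊩ vs d′ e₂) q
        (≡-trans (+-assoc c _ _) (cong (c +_) (+-interchange a b x y)))

    subst-⊩* : ∀ {σ : Fin m → Term n} → (∀ x → Value (σ x)) → ∀ {G D Js a b} →
               G ⊩* Js ▹ a → D ⊩* relabel σ G ▹ b → D ⊩* relabel (subst σ) Js ▹ a + b
    subst-⊩* {σ = σ} vs (nil p) e = permute (relabel-↭ σ (↭-sym p)) e
    subst-⊩* {σ = σ} vs (cons {H = H} {a = a} {b} d d′ p refl) e with split-image σ {H = H} p e
    ... | _ , _ , x , y , q , refl , e₁ , e₂ =
      cons (subst-⊩ˡ vs d e₁) (subst-⊩* vs d′ e₂) q (+-interchange a b x y)

  -- Subject reduction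

  -- The weight b and the context outside the hole stay fixed while the hole
  -- receives any r′, possibly using further variables K of the outer scope.
  Plugged : ∀ {k n} → SubstCtx n k → Term k → Occs n → Multi → ℕ → Set
  Plugged L r G M s = ∃[ J ] ∃[ a ] ∃[ b ] (J ⊩ r ∶ M ▹ a × s ≡ a + b ×
    (∀ K {r′ N x} → J ++ relabel (wk L) K ⊩ r′ ∶ N ▹ x → G ++ K ⊩ L ⟨ r′ ⟩ᴸ ∶ N ▹ x + b))

  -- Each substitution of `L` adds `c` and the weight of its content to `b`. Under its binder `K` is
  -- shifted by `suc`, which is what `wk` composes.
  unplug : ∀ (L : SubstCtx n k) {r G M s} → G ⊩ L ⟨ r ⟩ᴸ ∶ M ▹ s → Plugged L r G M s
  unplug □ {G = G} {s = s} d = G , s , 0 , d , sym (+-identityʳ s) , λ K {x = x} e →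
    reweigh (sym (+-identityʳ x)) (exchange (++⁺ ↭-refl (↭-reflexive (sym (map-id K)))) e)
  unplug (L [← t ]) (es {M = M} {H = H} {I} {b = y} d d′ p refl) with unplug L d
  ... | J , a , b , e , refl , plug = J , a , c + (b + y) , e , pull-es c a b y , λ K {x = x} f →
    es (exchange (↭-reflexive (sym (bind-++ M H K)))
         (plug (relabel suc K) (exchange (++⁺ ↭-refl (↭-reflexive (sym (map-∘ K)))) f)))
      d′ (trans (++⁺ p ↭-refl) (xy∙z≈xz∙y H I K)) (sym (pull-es c x b y))

  -- `α` is the weight lost by the step, `β` the weight gained and `h` the common rest. Open
  -- contexts then only enlarge `h`, and no subtraction occurs.
  Exact : ℕ → ℕ → Term n → Term n → Set
  Exact {n} α β t t′ = ∀ {G : Occs n} {M s} → G ⊩ t ∶ M ▹ s → ∃[ h ] (s ≡ α + h × G ⊩ t′ ∶ M ▹ β + h)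

  -- The 2 is the rule λ and the rule @ of the redex; `c` is the new rule es.
  root-m-exact : {t t′ : Term n} → t ↦m t′ → Exact 2 c t t′
  root-m-exact (root-m L t u) (app {K = K} {b = b} d e p refl) with unplug L d
  ... | J , _ , y , f , refl , plug with singleton (family (ƛ t) f)
  -- The type of a function is a singleton, so exactly one rule λ types the abstraction.
  ... | lam {H = I} {s = a} g q = a + b + y , lemma₁ a b y , exchange p
    (reweigh (lemma₂ c a b y) (plug K (es g (rename-⊩ (wk L) e) (++⁺ q ↭-refl) refl)))
    where
      lemma₁ : ∀ a b y → suc (suc a + y + b) ≡ 2 + (a + b + y)
      lemma₁ = solve-∀
      lemma₂ : ∀ c a b y → c + (a + b) + y ≡ c + (a + b + y)
      lemma₂ = solve-∀

  -- The derivations of `v`, one for each type in `M`, move with their weight into the body through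
  -- `subst-⊩`; only the `c` of the rule es disappears.
  root-e-exact : {t t′ : Term n} → t ↦e t′ → Exact c 0 t t′
  root-e-exact (root-e t L v) (es {M = M} {H = H} {K} {a} d e p refl) with unplug L e
  ... | J , x , y , f , refl , plug = a + (x + y) , refl ,
    exchange (trans p (++-comm H K))
      (reweigh (+-assoc a x y) (plug H (subst-⊩ values (rename-bind (wk L) M H d)
        (retype (sym image) (reweigh* (+-identityʳ x)
          (append (family v f) (variables (relabel (wk L) H))))))))
    where
      values : ∀ i → Value ((_ ∷ᵛ var) i)
      values zero    = v
      values (suc i) = var i
      image : relabel (_ ∷ᵛ var) (bind M (relabel (wk L) H)) ≡ label _ M ++ relabel var (relabel (wk L) H)
      image = ≡-trans (map-++ _ (label zero M) _) (cong₂ _++_ (sym (map-∘ M)) (sym (map-∘ (relabel (wk L) H))))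

  module _ {α β : ℕ} where

    -- Open contexts do not enter abstractions, so a derivation of the whole term types the hole
    -- exactly once.
    open-exact : (O : OpenCtx n k) {r r′ : Term k} → Exact α β r r′ → Exact α β (O ⟨ r ⟩ᴼ) (O ⟨ r′ ⟩ᴼ)
    open-exact □ step d = step d
    open-exact (O ·ˡ u) step (app {b = b} d e p refl) with open-exact O step d
    ... | h , refl , d′ = suc (h + b) , pull-app α h b , app d′ e p (sym (pull-app β h b))
    open-exact (t ·ʳ O) step (app {a = a} d e p refl) with open-exact O step e
    ... | h , refl , e′ = suc (a + h) , lemma α a h , app d e′ p (sym (lemma β a h))
      where
        lemma : ∀ α a h → suc (a + (α + h)) ≡ α + suc (a + h)
        lemma = solve-∀
    open-exact (O [← u ]ˡ) step (es {b = b} d e p refl) with open-exact O step d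
    ... | h , refl , d′ = c + (h + b) , pull-es c α h b , es d′ e p (sym (pull-es c β h b))
    open-exact (t [← O ]ʳ) step (es {a = a} d e p refl) with open-exact O step e
    ... | h , refl , e′ = c + (a + h) , lemma c α a h , es d e′ p (sym (lemma c β a h))
      where
        lemma : ∀ c α a h → c + (a + (α + h)) ≡ α + (c + (a + h))
        lemma = solve-∀

    -- A step below λ is performed once for each type of the abstraction, hence
    -- the number of copies, which is one for unitary types.
    Scaled : (Occs n → Multi → ℕ → Set) → Occs n → Multi → ℕ → Set
    Scaled J G M s = ∃[ j ] ∃[ h ]
      (s ≡ suc j * α + h × J G M (suc j * β + h) × (UnitarySolvable M → j ≡ 0))

    -- Each element of the multi type has its own derivation of the abstraction, with its own copies
    -- of the step. A solvable multi type is nonempty, so the total is positive and can be written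
    -- `suc j`.
    lam-scaled : {t t′ : Term (suc n)} →
      (∀ {G M s} → Solvable M → G ⊩ t ∶ M ▹ s → Scaled (_⊩ t′ ∶_▹_) G M s) →
      ∀ {G M s} → Solvable M → G ⊩* label (ƛ t) M ▹ s → Scaled (λ H N → H ⊩* label (ƛ t′) N ▹_) G M s
    lam-scaled step {M = _ ∷ []} (nonempty ((_ ⊸ sN) ∷ [])) (cons (lam d q) (nil q′) p refl) with step sN d
    ... | j , h , refl , d′ , one = j , suc h , lemma (suc j * α) h ,
      cons (lam d′ q) (nil q′) p (sym (lemma (suc j * β) h)) , λ { (unit (_ ⊸ uN)) → one uN }
      where
        lemma : ∀ x h → suc (x + h) + 0 ≡ x + suc h
        lemma = solve-∀
    lam-scaled step {M = _ ∷ _ ∷ _} (nonempty ((_ ⊸ sN) ∷ ss)) (cons (lam d q) e p refl)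
      with step sN d | lam-scaled step (nonempty ss) e
    -- The total `suc i + suc j` is `suc (i + suc j)`. With two elements or more the type is not
    -- unitary.
    ... | i , h , refl , d′ , _ | j , l , refl , e′ , _ = i + suc j , suc (h + l) , lemma i j α h l ,
      cons (lam d′ q) e′ p (sym (lemma i j β h l)) , λ ()
      where
        lemma : ∀ i j x h l → suc (suc i * x + h) + (suc j * x + l) ≡ suc (i + suc j) * x + suc (h + l)
        lemma = solve-∀

    -- Solvability and unitarity of an arrow look only at its target. Hence both pass from the type
    -- of an application to the singleton type of its function, and from the type of an abstraction
    -- to that of its body.
    solv-scaled : (S : SolvCtx n k) {r r′ : Term k} → Exact α β r r′ →
      ∀ {G M s} → Solvable M → G ⊩ S ⟨ r ⟩ˢ ∶ M ▹ s → Scaled (_⊩ S ⟨ r′ ⟩ˢ ∶_▹_) G M s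
    solv-scaled (open′ O) step sM d with open-exact O step d
    ... | h , refl , d′ = 0 , h , cong (_+ h) (sym (*-identityˡ α)) ,
      reweigh (cong (_+ h) (sym (*-identityˡ β))) d′ , λ _ → refl
    solv-scaled (ƛ S) step sM d with lam-scaled (solv-scaled S step) sM (family (ƛ _) d)
    ... | j , h , eq , d′ , one = j , h , eq , many (ƛ _) d′ (refl ≋ᵐ-refl) , one
    solv-scaled (S ·ˡ u) step sN (app {b = b} d e p refl)
      with solv-scaled S step (nonempty ((_ ⊸ sN) ∷ [])) d
    ... | j , h , refl , d′ , one = j , suc (h + b) , pull-app (suc j * α) h b ,
      app d′ e p (sym (pull-app (suc j * β) h b)) , λ uN → one (unit (_ ⊸ uN))
    solv-scaled (S [← u ]ˡ) step sN (es {b = b} d e p refl) with solv-scaled S step sN d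
    ... | j , h , refl , d′ , one = j , c + (h + b) , pull-es c (suc j * α) h b ,
      es d′ e p (sym (pull-es c (suc j * β) h b)) , one

  -- Weights bound sizes

  -- Each application outside abstractions is typed by its own rule @.
  ∣∣ᵒ≤ : ∀ {G : Occs n} {t M s} → G ⊩ t ∶ M ▹ s → ∣ t ∣ᵒ ≤ s
  ∣∣ᵒ≤ (many (var x) _ _) = z≤n
  ∣∣ᵒ≤ (many (ƛ t) _ _)   = z≤n
  ∣∣ᵒ≤ {t = t · u} (app d e _ refl) =
    ≤-trans (≤-reflexive (+-comm _ 1)) (s≤s (+-mono-≤ (∣∣ᵒ≤ d) (∣∣ᵒ≤ e)))
  ∣∣ᵒ≤ (es d e _ refl) = ≤-trans (+-mono-≤ (∣∣ᵒ≤ d) (∣∣ᵒ≤ e)) (m≤n+m _ c)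

  -- The abstractions that this size counts lie on the head path, where a solvable type provides at
  -- least one rule λ for each.
  ∣∣ˢ≤ : ∀ (t : Term n) {G M s} → Solvable M → G ⊩ t ∶ M ▹ s → ∣ t ∣ˢ ≤ s
  ∣∣ˢ≤ (var x) _ _ = z≤n
  ∣∣ˢ≤ (ƛ t) (nonempty (sA ∷ _)) d with family (ƛ t) d | sA
  ... | cons (lam e _) _ _ refl | _ ⊸ sN =
    ≤-trans (≤-reflexive (+-comm _ 1)) (s≤s (≤-trans (∣∣ˢ≤ t sN e) (m≤m+n _ _)))
  ∣∣ˢ≤ (t · u) sN (app d e _ refl) = ≤-trans (≤-reflexive (+-comm _ 1))
    (s≤s (+-mono-≤ (∣∣ˢ≤ t (nonempty ((_ ⊸ sN) ∷ [])) d) (∣∣ᵒ≤ e)))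
  ∣∣ˢ≤ (t [← u ]) sN (es d e _ refl) = ≤-trans (+-mono-≤ (∣∣ˢ≤ t sN d) (∣∣ᵒ≤ e)) (m≤n+m _ c)

  -- The witness `j` is the number of rules es, so its contribution vanishes for `c = 0`.
  embed  : ∀ {Γ : TypeCtx n} {t M} (Φ : Γ ⊢ t ∶ M) → ∃[ j ] flatten Γ ⊩ t ∶ M ▹ ∣ Φ ∣ᵐ + c * j
  embedˡ : ∀ {Γ : TypeCtx n} {t A} (Φ : Γ ⊢ˡ t ∶ A) → ∃[ j ] flatten Γ ⊩ˡ t ∶ A ▹ ∣ Φ ∣ᵐˡ + c * j
  embed* : ∀ {v : Term n} {Ps} (Φs : All (λ P → proj₁ P ⊢ˡ v ∶ proj₂ P) Ps) →
           ∃[ j ] flatten (⨄ (map proj₁ Ps)) ⊩* label v (map proj₂ Ps) ▹ ∣ Φs ∣ᵐ* + c * j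

  embed (many v Ps Φs p q) with embed* Φs
  ... | j , d = j , many v (exchange* (flatten-≈ p) d) q
  embed (app Δ Θ Φ Ψ p) with embed Φ | embed Ψ
  ... | i , d | j , e = i + j ,
    app d e (trans (flatten-≈ p) (flatten-⊎ Δ Θ)) (cong suc (weight-+ ∣ Φ ∣ᵐ ∣ Ψ ∣ᵐ c i j))
  embed (es Δ Θ Φ Ψ p) with embed Φ | embed Ψ
  ... | i , d | j , e = suc (i + j) ,
    es d e (trans (flatten-≈ p) (flatten-⊎ Δ Θ)) (lemma ∣ Φ ∣ᵐ ∣ Ψ ∣ᵐ c i j)
    where
      lemma : ∀ a b c i j → a + b + c * suc (i + j) ≡ c + ((a + c * i) + (b + c * j))
      lemma = solve-∀

  embedˡ (ax {x} p) = 0 , reweighˡ (sym (*-zeroʳ c)) (ax (trans (flatten-≈ p) (flatten-↦ x)))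
  embedˡ (lam Φ) with embed Φ
  ... | j , d = j , lam d ↭-refl

  embed* {n = n} [] = 0 , reweigh* (sym (*-zeroʳ c)) (nil (↭-reflexive (flatten-𝟎 n)))
  embed* (_∷_ {P} {Ps} Φ Φs) with embedˡ Φ | embed* Φs
  ... | i , d | j , e = i + j ,
    cons d e (flatten-⊎ (proj₁ P) (⨄ (map proj₁ Ps))) (weight-+ ∣ Φ ∣ᵐˡ ∣ Φs ∣ᵐ* c i j)


-- Normal forms and progress

-- The head constructor below the substitution context L of a term L⟨r⟩.
data Tail : Set where
  varᵗ absᵗ appᵗ : Tail

tail : Term n → Tail
tail (var x)    = varᵗ
tail (ƛ t)      = absᵗ
tail (t · u)    = appᵗ
tail (t [← u ]) = tail t

tail-plug : (L : SubstCtx n k) {r : Term k} → tail (L ⟨ r ⟩ᴸ) ≡ tail r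
tail-plug □          = refl
tail-plug (L [← t ]) = tail-plug L

app⇒¬abs : {τ : Tail} → τ ≡ appᵗ → ¬ τ ≡ absᵗ
app⇒¬abs refl ()

-- Every term is `L ⟨ r ⟩ᴸ` with `r` a value or an application; this view decides whether a root
-- rule applies around it.
data Shape : Term n → Set where
  value       : (L : SubstCtx n k) {v : Term k} → Value v → Shape (L ⟨ v ⟩ᴸ)
  application : (L : SubstCtx n k) (t u : Term k) → Shape (L ⟨ t · u ⟩ᴸ)

shape : (t : Term n) → Shape t
shape (var x) = value □ (var x)
shape (ƛ t)   = value □ (ƛ t)
shape (t · u) = application □ t u
shape (t [← u ]) with shape t
... | value L v         = value (L [← u ]) v
... | application L r s = application (L [← u ]) r s

data Mode : Set where
  openᵐ solvingᵐ : Mode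

-- The side conditions exclude root redexes: a function with tail `absᵗ` gives an m-redex, and the
-- content of a substitution gives an e-redex unless its tail is `appᵗ`. The mode `openᵐ` leaves
-- bodies of abstractions arbitrary.
data Nf {n : ℕ} : Mode → Term n → Set where
  var  : ∀ {μ} x → Nf μ (var x)
  ƛ-o  : ∀ t → Nf openᵐ (ƛ t)
  ƛ-s  : ∀ {t} → Nf solvingᵐ t → Nf solvingᵐ (ƛ t)
  app  : ∀ {μ t u} → Nf μ t → Nf openᵐ u → ¬ tail t ≡ absᵗ → Nf μ (t · u)
  es   : ∀ {μ t u} → Nf μ t → Nf openᵐ u → tail u ≡ appᵗ → Nf μ (t [← u ])

infix 4 _↦ʳ_

_↦ʳ_ : Rel (Term n) 0ℓ
t ↦ʳ t′ = t ↦m t′ ⊎ t ↦e t′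

Nf-root : ∀ {μ} {t t′ : Term n} → Nf μ t → ¬ t ↦ʳ t′
Nf-root (app _ _ ¬abs) (inj₁ (root-m L _ _))       = ¬abs (tail-plug L)
Nf-root (es _ _ isApp) (inj₂ (root-e _ L (var x))) with () ← ≡-trans (sym (tail-plug L)) isApp
Nf-root (es _ _ isApp) (inj₂ (root-e _ L (ƛ t)))   with () ← ≡-trans (sym (tail-plug L)) isApp

Nf-open : ∀ {μ} (O : OpenCtx n k) {r r′} → Nf μ (O ⟨ r ⟩ᴼ) → ¬ r ↦ʳ r′
Nf-open □           nf         = Nf-root nf
Nf-open (O ·ˡ u)    (app a _ _) = Nf-open O a
Nf-open (t ·ʳ O)    (app _ b _) = Nf-open O b
Nf-open (O [← u ]ˡ) (es a _ _)  = Nf-open O a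
Nf-open (t [← O ]ʳ) (es _ b _)  = Nf-open O b

Nf-solving : (S : SolvCtx n k) {r r′ : Term k} → Nf solvingᵐ (S ⟨ r ⟩ˢ) → ¬ r ↦ʳ r′
Nf-solving (open′ O)   nf          = Nf-open O nf
Nf-solving (ƛ S)       (ƛ-s a)     = Nf-solving S a
Nf-solving (S ·ˡ u)    (app a _ _) = Nf-solving S a
Nf-solving (S [← u ]ˡ) (es a _ _)  = Nf-solving S a

Nf-normal : {t u : Term n} → Nf solvingᵐ t → ¬ t →s u
Nf-normal nf (inj₁ (close S x)) = Nf-solving S nf (inj₁ x)
Nf-normal nf (inj₂ (close S x)) = Nf-solving S nf (inj₂ x)

data OpenReducible {n : ℕ} : Term n → Set where
  reduce : (O : OpenCtx n k) {r r′ : Term k} → r ↦ʳ r′ → OpenReducible (O ⟨ r ⟩ᴼ)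

data SolvReducible {n : ℕ} : Term n → Set where
  reduce : (S : SolvCtx n k) {r r′ : Term k} → r ↦ʳ r′ → SolvReducible (S ⟨ r ⟩ˢ)

app-shape : (t u : Term n) → (∃ (t · u ↦ʳ_)) ⊎ ¬ tail t ≡ absᵗ
app-shape t u with shape t
... | value L (ƛ r)       = inj₁ (_ , inj₁ (root-m L r u))
... | value L (var x)     = inj₂ λ eq → contradiction (≡-trans (sym (tail-plug L)) eq) λ ()
... | application L r s   = inj₂ (app⇒¬abs (tail-plug L))

es-shape : (t : Term (suc n)) (u : Term n) → (∃ (t [← u ] ↦ʳ_)) ⊎ tail u ≡ appᵗ
es-shape t u with shape u
... | value L v         = inj₁ (_ , inj₂ (root-e t L v))
... | application L r s = inj₂ (tail-plug L)

progressᵒ : (t : Term n) → Nf openᵐ t ⊎ OpenReducible t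
progressᵒ (var x) = inj₁ (var x)
progressᵒ (ƛ t)   = inj₁ (ƛ-o t)
progressᵒ (t · u) with progressᵒ t | progressᵒ u | app-shape t u
... | inj₂ (reduce O x) | _                 | _            = inj₂ (reduce (O ·ˡ u) x)
... | inj₁ _            | inj₂ (reduce O x) | _            = inj₂ (reduce (t ·ʳ O) x)
... | inj₁ _            | inj₁ _            | inj₁ (_ , x) = inj₂ (reduce □ x)
... | inj₁ a            | inj₁ b            | inj₂ ¬abs    = inj₁ (app a b ¬abs)
progressᵒ (t [← u ]) with progressᵒ t | progressᵒ u | es-shape t u
... | inj₂ (reduce O x) | _                 | _            = inj₂ (reduce (O [← u ]ˡ) x)
... | inj₁ _            | inj₂ (reduce O x) | _            = inj₂ (reduce (t [← O ]ʳ) x)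
... | inj₁ _            | inj₁ _            | inj₁ (_ , x) = inj₂ (reduce □ x)
... | inj₁ a            | inj₁ b            | inj₂ isApp   = inj₁ (es a b isApp)

progressˢ : (t : Term n) → Nf solvingᵐ t ⊎ SolvReducible t
progressˢ (var x) = inj₁ (var x)
progressˢ (ƛ t) with progressˢ t
... | inj₁ a            = inj₁ (ƛ-s a)
... | inj₂ (reduce S x) = inj₂ (reduce (ƛ S) x)
-- Solving contexts reach the argument only through an open context, so it is analysed in the open
-- mode.
progressˢ (t · u) with progressˢ t | progressᵒ u | app-shape t u
... | inj₂ (reduce S x) | _                 | _            = inj₂ (reduce (S ·ˡ u) x)
... | inj₁ _            | inj₂ (reduce O x) | _            = inj₂ (reduce (open′ (t ·ʳ O)) x)
... | inj₁ _            | inj₁ _            | inj₁ (_ , x) = inj₂ (reduce (open′ □) x)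
... | inj₁ a            | inj₁ b            | inj₂ ¬abs    = inj₁ (app a b ¬abs)
progressˢ (t [← u ]) with progressˢ t | progressᵒ u | es-shape t u
... | inj₂ (reduce S x) | _                 | _            = inj₂ (reduce (S [← u ]ˡ) x)
... | inj₁ _            | inj₂ (reduce O x) | _            = inj₂ (reduce (open′ (t [← O ]ʳ)) x)
... | inj₁ _            | inj₁ _            | inj₁ (_ , x) = inj₂ (reduce (open′ □) x)
... | inj₁ a            | inj₁ b            | inj₂ isApp   = inj₁ (es a b isApp)

step? : (t : Term n) → Nf solvingᵐ t ⊎ ∃ (t →s_)
step? t with progressˢ t
... | inj₁ nf                  = inj₁ nf
... | inj₂ (reduce S (inj₁ x)) = inj₂ (_ , inj₁ (close S x))
... | inj₂ (reduce S (inj₂ x)) = inj₂ (_ , inj₂ (close S x))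

-- Inert types

-- These are the multi types `n[X]`. As a predicate on elements, it is carried along permutations by
-- plain recursion; `pure⇒replicate` then recovers the form that `InertLinear` demands.
Pure : Multi → Set
Pure = All (_≡ X)

mutual
  pure-resp : ∀ {M N} → M ≈ᵐ N → Pure M → Pure N
  pure-resp (refl p)     ps            = pure-resp-≋ p ps
  pure-resp (prep X p)   (refl ∷ ps)   = refl ∷ pure-resp p ps
  pure-resp (swap X X p) (refl ∷ refl ∷ ps) = refl ∷ refl ∷ pure-resp p ps
  pure-resp (trans p q)  ps            = pure-resp q (pure-resp p ps)

  pure-resp-≋ : ∀ {M N} → Pointwise _≈ˡ_ M N → Pure M → Pure N
  pure-resp-≋ []      []          = []
  pure-resp-≋ (X ∷ p) (refl ∷ ps) = refl ∷ pure-resp-≋ p ps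

pure⇒replicate : ∀ {M} → Pure M → ∃[ j ] M ≡ replicate j X
pure⇒replicate []          = 0 , refl
pure⇒replicate (refl ∷ ps) with pure⇒replicate ps
... | j , refl = suc j , refl

mutual
  inertˡ-resp : ∀ {A B} → A ≈ˡ B → InertLinear A → InertLinear B
  inertˡ-resp X       X       = X
  inertˡ-resp (p ⊸ q) (j ⊸ i) with pure⇒replicate (pure-resp p (replicate⁺ j refl))
  ... | l , refl = l ⊸ inert-resp q i

  inert-resp : ∀ {M N} → M ≈ᵐ N → Inert M → Inert N
  inert-resp (refl p)     is            = inert-resp-≋ p is
  inert-resp (prep e p)   (i ∷ is)      = inertˡ-resp e i ∷ inert-resp p is
  inert-resp (swap e f p) (i ∷ i′ ∷ is) = inertˡ-resp f i′ ∷ inertˡ-resp e i ∷ inert-resp p is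
  inert-resp (trans p q)  is            = inert-resp q (inert-resp p is)

  inert-resp-≋ : ∀ {M N} → Pointwise _≈ˡ_ M N → Inert M → Inert N
  inert-resp-≋ []      []       = []
  inert-resp-≋ (e ∷ p) (i ∷ is) = inertˡ-resp e i ∷ inert-resp-≋ p is

InertOccs : Occs n → Set
InertOccs = All (InertLinear ∘ proj₂)

inertOccs-resp : {G H : Occs n} → G ↭ H → InertOccs G → InertOccs H
inertOccs-resp = SetoidPermutationProperties.All-resp-↭ (typedSetoid _) (inertˡ-resp ∘ proj₂)

inert-++⁻ : {G : Occs n} (H : Occs n) {K : Occs n} → G ↭ H ++ K → InertOccs G → InertOccs H × InertOccs K
inert-++⁻ H p i = ++⁻ H (inertOccs-resp p i)

inert-bind : ∀ {M} {G : Occs n} → Inert M → InertOccs G → InertOccs (bind M G)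
inert-bind iM iG = ++⁺ᴬ (map⁺ iM) (map⁺ iG)

inert-flatten : {Γ : TypeCtx n} → InertCtx Γ → InertOccs (flatten Γ)
inert-flatten {zero}  i = []
inert-flatten {suc n} i = inert-bind (i zero) (inert-flatten (i ∘ suc))

-- Exact weights, with rules es counted 0

module Exactness where
  open Weighted 0

  inert-var : ∀ {G : Occs n} {x M s} → InertOccs G → G ⊩* label (var x) M ▹ s → Inert M × 0 ≡ s
  inert-var {M = []}    _ (nil _) = [] , refl
  inert-var {M = _ ∷ _} i (cons (ax p) d q refl) with inert-++⁻ _ q i
  ... | iH , iK with inertOccs-resp p iH | inert-var iK d
  ... | iA ∷ [] | iM , refl = iA ∷ iM , refl

  mutual
    -- Inertness passes from the head variable through the targets of its arrows. The content of a
    -- substitution is an application under substitutions, so its type is inert too and the context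
    -- stays inert under the binder.
    inert-exact : ∀ {μ} {G : Occs n} {t M s} → Nf μ t → ¬ tail t ≡ absᵗ →
                  InertOccs G → G ⊩ t ∶ M ▹ s → Inert M × ∣ t ∣ᵒ ≡ s
    inert-exact (var x) _ i d = inert-var i (family (var x) d)
    inert-exact (ƛ-o t) ¬abs  = contradiction refl ¬abs
    inert-exact (ƛ-s a) ¬abs  = contradiction refl ¬abs
    inert-exact {t = t · u} (app a b ¬abs) _ i (app {H = H} d e p refl) with inert-++⁻ H p i
    ... | iH , iK with inert-exact a ¬abs iH d
    -- An inert arrow has source `replicate j X`, which brings the argument under `pure-exact`.
    ... | (j ⊸ iN) ∷ [] , refl = iN ,
      ≡-trans (+-comm _ 1) (cong (λ x → suc (∣ t ∣ᵒ + x)) (pure-exact b iK (replicate⁺ j refl) e))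
    inert-exact (es a b isApp) ¬abs i (es {H = H} d e p refl) with inert-++⁻ H p i
    ... | iH , iK with inert-exact b (app⇒¬abs isApp) iK e
    ... | iM , refl with inert-exact a ¬abs (inert-bind iM iH) d
    ... | iN , refl = iN , refl

    -- No abstraction has type `X`, so at a type `n[X]` it is typed by the empty family, whose
    -- weight 0 agrees with its open size.
    pure-exact : ∀ {G : Occs n} {t M s} → Nf openᵐ t → InertOccs G → Pure M → G ⊩ t ∶ M ▹ s → ∣ t ∣ᵒ ≡ s
    pure-exact (var x) i _ d = proj₂ (inert-var i (family (var x) d))
    pure-exact (ƛ-o t) i ps d with ps | family (ƛ t) d
    ... | []       | nil _ = refl
    ... | refl ∷ _ | cons () _ _ _
    pure-exact nf@(app _ _ _) i _ d = proj₂ (inert-exact nf (λ ()) i d)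
    pure-exact (es a b isApp) i ps (es {H = H} d e p refl) with inert-++⁻ H p i
    ... | iH , iK with inert-exact b (app⇒¬abs isApp) iK e
    ... | iM , refl = cong (_+ _) (pure-exact a (inert-bind iM iH) ps d)

  -- The two sizes differ only by abstractions on the head path, and these normal forms have none
  -- there.
  ∣∣ˢ≡∣∣ᵒ : ∀ {μ} {t : Term n} → Nf μ t → ¬ tail t ≡ absᵗ → ∣ t ∣ˢ ≡ ∣ t ∣ᵒ
  ∣∣ˢ≡∣∣ᵒ (var x)         _    = refl
  ∣∣ˢ≡∣∣ᵒ (ƛ-o t)         ¬abs = contradiction refl ¬abs
  ∣∣ˢ≡∣∣ᵒ (ƛ-s a)         ¬abs = contradiction refl ¬abs
  ∣∣ˢ≡∣∣ᵒ (app a _ ¬abs) _    = cong (λ x → x + _ + 1) (∣∣ˢ≡∣∣ᵒ a ¬abs)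
  ∣∣ˢ≡∣∣ᵒ (es a _ _)      ¬abs = cong (_+ _) (∣∣ˢ≡∣∣ᵒ a ¬abs)

  -- Unitarity gives exactly one rule λ per abstraction on the head path, and inert solvability
  -- makes the source of its arrow inert, so the context of the body stays inert.
  precise-exact : ∀ {G : Occs n} {t M s} → Nf solvingᵐ t → InertOccs G → PreciselySolvable M →
                  G ⊩ t ∶ M ▹ s → ∣ t ∣ˢ ≡ s
  precise-exact (var x) i _ d = proj₂ (inert-var i (family (var x) d))
  precise-exact (ƛ-s a) i (unit uA , nonempty (iA ∷ [])) d with uA | iA | singleton (family (ƛ _) d)
  ... | _ ⊸ uN | iM ⊸ isN | lam e p = ≡-trans (+-comm _ 1)
    (cong suc (precise-exact a (inert-bind iM (inertOccs-resp p i)) (uN , isN) e))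
  precise-exact nf@(app _ _ _) i _ d =
    ≡-trans (∣∣ˢ≡∣∣ᵒ nf (λ ())) (proj₂ (inert-exact nf (λ ()) i d))
  precise-exact (es a b isApp) i ps (es {H = H} d e p refl) with inert-++⁻ H p i
  ... | iH , iK with inert-exact b (app⇒¬abs isApp) iK e
  ... | iM , refl = cong (_+ _) (precise-exact a (inert-bind iM iH) ps d)

  -- An e-step keeps the weight and an m-step takes 2 for each of its `suc j` copies. Counting one
  -- copy gives the bound; a unitary type forces `j ≡ 0` and equality.
  trace : ∀ {G : Occs n} {t u M s} (d : t →s* u) → Solvable M → G ⊩ t ∶ M ▹ s →
          ∃[ s′ ] (G ⊩ u ∶ M ▹ s′ × 2 * ∣ d ∣ᵈ + s′ ≤ s × (UnitarySolvable M → 2 * ∣ d ∣ᵈ + s′ ≡ s))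
  trace ε sM Φ = _ , Φ , ≤-refl , λ _ → refl
  trace (inj₁ (close S x) ◅ d) sM Φ with solv-scaled S (root-m-exact x) sM Φ
  ... | j , h , refl , Φ′ , one with trace d sM (reweigh (cong (_+ h) (*-zeroʳ j)) Φ′)
  ... | s′ , Ψ , le , eq = s′ , Ψ ,
    ≤-trans (≤-reflexive (lemma ∣ d ∣ᵈ s′)) (s≤s (s≤s (≤-trans le (m≤n+m h (j * 2))))) ,
    λ uM → ≡-trans (lemma ∣ d ∣ᵈ s′) (cong₂ (λ i x → 2 + (i * 2 + x)) (sym (one uM)) (eq uM))
    where
      lemma : ∀ l s → 2 * suc l + s ≡ 2 + (2 * l + s)
      lemma = solve-∀
  trace (inj₂ (close S x) ◅ d) sM Φ with solv-scaled S (root-e-exact x) sM Φ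
  ... | j , h , refl , Φ′ , _ with trace d sM Φ′
  ... | s′ , Ψ , le , eq = s′ , Ψ , le , eq

-- Termination, with rules es counted 1

module Termination where
  open Weighted 1

  -- Each of the `suc j` copies loses 1: from 2 to 1 in an m-step, from 1 to 0 in an e-step.
  step-decreases : ∀ {G : Occs n} {t t′ M s} → Solvable M → t →s t′ → G ⊩ t ∶ M ▹ s →
                   ∃[ s′ ] (s′ < s × G ⊩ t′ ∶ M ▹ s′)
  step-decreases sM (inj₁ (close S x)) Φ with solv-scaled S (root-m-exact x) sM Φ
  ... | j , h , refl , Φ′ , _ = _ , s≤s (s≤s (+-monoˡ-≤ h (*-monoʳ-≤ j (s≤s z≤n)))) , Φ′
  step-decreases sM (inj₂ (close S x)) Φ with solv-scaled S (root-e-exact x) sM Φ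
  ... | j , h , refl , Φ′ , _ = _ , s≤s (+-monoˡ-≤ h (*-monoʳ-≤ j z≤n)) , Φ′

  normalise : ∀ s {G : Occs n} {t M} → Solvable M → G ⊩ t ∶ M ▹ s → ∃[ u ] (t →s* u × Nf solvingᵐ u)
  normalise {n} s {M = M} sM Φ = <-rec
    (λ s → ∀ {G : Occs n} {t} → G ⊩ t ∶ M ▹ s → ∃[ u ] (t →s* u × Nf solvingᵐ u)) go s Φ
    where
      go : ∀ s → (∀ {s′} → s′ < s → ∀ {G : Occs n} {t} → G ⊩ t ∶ M ▹ s′ → ∃[ u ] (t →s* u × Nf solvingᵐ u)) →
           ∀ {G : Occs n} {t} → G ⊩ t ∶ M ▹ s → ∃[ u ] (t →s* u × Nf solvingᵐ u)
      go s rec {t = t} Φ with step? t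
      ... | inj₁ nf = t , ε , nf
      ... | inj₂ (_ , r) with step-decreases sM r Φ
      ... | _ , s′<s , Φ′ with rec s′<s Φ′
      ... | u , d , nf = u , r ◅ d , nf

theorem9p3 : {n : ℕ} {Γ : TypeCtx n} {t : Term n} {M : Multi} (Φ : Γ ⊢ t ∶ M) → Solvable M →
    ∃[ u ] Σ[ d ∈ t →s* u ]
    ( IsNormalForm _→s_ u
    × 2 * ∣ d ∣ᵈ + ∣ u ∣ˢ ≤ ∣ Φ ∣ᵐ
    × (InertCtx Γ → PreciselySolvable M → 2 * ∣ d ∣ᵈ + ∣ u ∣ˢ ≡ ∣ Φ ∣ᵐ))
theorem9p3 Φ sM
  with Termination.normalise _ sM (proj₂ (Weighted.embed 1 Φ))
... | u , d , nf
  -- The sequence `d`, found with `c = 1`, is traced again with `c = 0`, where the initial weight is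
  -- `∣ Φ ∣ᵐ` itself.
  with Exactness.trace d sM (Weighted.reweigh 0 (+-identityʳ ∣ Φ ∣ᵐ) (proj₂ (Weighted.embed 0 Φ)))
... | s , Ψ , le , eq =
  u , d , (λ (_ , r) → Nf-normal nf r) ,
  ≤-trans (+-monoʳ-≤ (2 * ∣ d ∣ᵈ) (Weighted.∣∣ˢ≤ 0 u sM Ψ)) le ,
  λ iΓ (uM , isM) → ≡-trans
    (cong (2 * ∣ d ∣ᵈ +_) (Exactness.precise-exact nf (inert-flatten iΓ) (uM , isM) Ψ)) (eq uM)
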